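{- Let $G=(V,E)$ be a star graph with $n\ge 1$ edges, let $R\ge 1$ be an integer, and let $K=\lceil \sqrt[R]{n}\,\rceil$. Let $e\mapsto(\pi_1(e),\dots,\pi_R(e))$ be any injective map from $E$ to $\{0,\dots,K-1\}^R$. Let $U$ consist of all pairs $(r,k)$ with $1\le r\le R$, $0\le k\le K-1$, and all triples $(r,s,k)$ with $1\le r<s\le R$, $0\le k\le K-1$. Label each edge $e\in E$ by $$[e]=\{(r,\pi_r(e)) : 1\le r\le R\}\cup\{(r,s,(\pi_r(e)+\pi_s(e)) \bmod K) : 1\le r<s\le R\}\subseteq U,$$ and for $S\subseteq E$ let $[S]=\bigcup_{e\in S}[e]$. Let $S\subseteq E$ be the edge set of a shortest path in $G$ between two vertices. Then there are no false positives for $S$; that is, there is no edge $f\in E$ with $f\notin S$ and $[f]\subseteq[S]$.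
   Context: A star graph with $n$ edges is a tree consisting of one central vertex joined by an edge to each of $n$ other vertices (leaves), with no other edges. A labelling of the edges of a graph $G=(V,E)$ with universal set $U$ assigns to each edge $e\in E$ a subset $[e]\subseteq U$; for $S\subseteq E$ one puts $[S]=\bigcup_{e\in S}[e]$ (so $[\emptyset]=\emptyset$). A false positive for $S$ is an edge $f\in E$ such that $f\notin S$ but $[f]\subseteq[S]$. A shortest path from $u$ to $v$ is a path from $u$ to $v$ with the minimum possible number of edges; it is identified with its set of edges, and paths with $0$ edges are allowed. Here $x \bmod K$ denotes the representative in $\{0,\dots,K-1\}$. The labelling in the claim is called the star labelling. -}

module Defs where

open import Data.Fin as Fin using (Fin; toℕ)
open import Data.Fin.Properties using (nonZeroIndex)
open import Data.List using (List; []; _∷_; length)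
open import Data.List.Membership.Propositional using () renaming (_∈_ to _∈ˡ_)
open import Data.List.Relation.Unary.Unique.Propositional using (Unique)
open import Data.Nat using (ℕ; zero; suc; _+_; _^_; _≤_; z≤n; s≤s; _≤?_; >-nonZero)
open import Data.Nat.DivMod using (_mod_)
open import Data.Nat.Properties
  using (≤-trans; ≰⇒>; n≤1+n; n<1+n; ^-monoˡ-≤; ^-monoˡ-<)
open import Data.Product using (∃; ∃-syntax; _×_; _,_)
open import Data.Sum using (_⊎_)
open import Data.Vec using (Vec; lookup)
open import Level using (0ℓ)
open import Relation.Binary.Construct.Closure.ReflexiveTransitive
  using (ε; _◅_) renaming (Star to ReflTransClosure)
open import Relation.Binary.PropositionalEquality using (_≡_; _≢_)
open import Relation.Nullary using (¬_; yes; no)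
open import Relation.Unary using (Pred; _∈_; _∉_; _⊆_; _≐_; _∪_)

-- Simple undirected graphs.  The order of the two ends of an edge is
-- arbitrary; they are only used through the symmetric relation Joins.
record Graph : Set₁ where
  field
    V    : Set
    E    : Set
    ends : E → V × V

  Joins : E → V → V → Set
  Joins e u v = ends e ≡ (u , v) ⊎ ends e ≡ (v , u)

  field
    loopless   : ∀ {e v} → ¬ Joins e v v
    noParallel : ∀ {e f u v} → Joins e u v → Joins f u v → e ≡ f

module _ (G : Graph) where
  open Graph G

  record IsStarGraph (n : ℕ) : Set where
    field
      centre        : V
      leaf          : Fin n → V
      leafInjective : ∀ {i j} → leaf i ≡ leaf j → i ≡ j
      leaf≢centre   : ∀ i → leaf i ≢ centre
      allVertices   : ∀ v → v ≡ centre ⊎ ∃[ i ] v ≡ leaf i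
      spoke         : ∀ i → ∃[ e ] Joins e centre (leaf i)
      allEdges      : ∀ e → ∃[ i ] Joins e centre (leaf i)

  Walk : V → V → Set
  Walk = ReflTransClosure (λ u v → ∃[ e ] Joins e u v)

  vertices : ∀ {u v} → Walk u v → List V
  vertices {u} ε       = u ∷ []
  vertices {u} (_ ◅ p) = u ∷ vertices p

  edges : ∀ {u v} → Walk u v → List E
  edges ε             = []
  edges ((e , _) ◅ p) = e ∷ edges p

  IsPath : ∀ {u v} → Walk u v → Set
  IsPath p = Unique (vertices p)

  IsShortestPath : ∀ {u v} → Walk u v → Set
  IsShortestPath {u} {v} p =
    IsPath p × (∀ (q : Walk u v) → IsPath q → length (edges p) ≤ length (edges q))

  IsShortestPathEdgeSet : Pred E 0ℓ → Set
  IsShortestPathEdgeSet S =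
    ∃[ u ] ∃[ v ] ∃[ p ] IsShortestPath {u} {v} p × S ≐ (_∈ˡ edges p)

Labelling : Set → Set → Set₁
Labelling E U = E → Pred U 0ℓ

module _ {E U : Set} (label : Labelling E U) where

  labelOfSet : Pred E 0ℓ → Pred U 0ℓ
  labelOfSet S x = ∃[ e ] e ∈ S × x ∈ label e

  FalsePositive : Pred E 0ℓ → Pred E 0ℓ
  FalsePositive S f = f ∉ S × label f ⊆ labelOfSet S

-- K = ⌈ n^(1/R) ⌉ for R ≥ 1: the least K with n^(1/R) ≤ K, i.e. n ≤ K ^ R.
IsCeilRoot : (R n K : ℕ) → Set
IsCeilRoot R n K = n ≤ K ^ R × (∀ m → n ≤ m ^ R → K ≤ m)

ceilRootExists : ∀ R n → 1 ≤ R → ∃[ K ] IsCeilRoot R n K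
ceilRootExists R zero    _   = 0 , z≤n , λ _ _ → z≤n
ceilRootExists R (suc n) 1≤R with ceilRootExists R n 1≤R
... | K , n≤K^R , least with suc n ≤? K ^ R
...   | yes n<K^R = K , n<K^R , λ m n<m^R → least m (≤-trans (n≤1+n n) n<m^R)
...   | no  n≮K^R = suc K , ≤-trans (s≤s n≤K^R) (^-monoˡ-< R {{>-nonZero 1≤R}} (n<1+n K))
                  , λ m n<m^R → ≰⇒> λ m≤K → n≮K^R (≤-trans n<m^R (^-monoˡ-≤ R m≤K))

_+mod_ : ∀ {K} → Fin K → Fin K → Fin K
_+mod_ {K} i j = (toℕ i + toℕ j) mod K
  where instance _ = nonZeroIndex i

-- Coordinates 1, …, R are indexed by Fin R.  The proof of r < s is irrelevant,
-- so that triples are determined by r, s and k.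
data StarUniverse (R K : ℕ) : Set where
  pair   : (r : Fin R) (k : Fin K) → StarUniverse R K
  triple : (r s : Fin R) .(r<s : r Fin.< s) (k : Fin K) → StarUniverse R K

starLabelling : ∀ {E : Set} {R K} → (E → Vec (Fin K) R) → Labelling E (StarUniverse R K)
starLabelling π e =
    (λ x → ∃[ r ] x ≡ pair r (lookup (π e) r))
  ∪ (λ x → ∃[ r ] ∃[ s ] ∃ λ (r<s : r Fin.< s) →
       x ≡ triple r s r<s (lookup (π e) r +mod lookup (π e) s))

{-# OPTIONS --safe #-}

-- A path in a star has at most two edges, since the centre is an end of every
-- edge.  Suppose [f] ⊆ [a] ∪ [b] with f ∉ {a, b}.  The pairs force each πᵣ(f)
-- to be πᵣ(a) or πᵣ(b), so by injectivity there are coordinates r and s with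
-- πᵣ(f) = πᵣ(b) ≠ πᵣ(a) and πₛ(f) = πₛ(a) ≠ πₛ(b).  Then the sum of
-- coordinates r and s of f differs modulo K from those of a and b, by
-- cancellation, so the triple of f at r and s is not covered.
module Submission where

open import Defs
open import Data.Empty using (⊥)
open import Data.Fin as Fin using (Fin; zero; toℕ)
open import Data.Fin.Properties
  using (_≟_; <-cmp; toℕ<n; toℕ≤n; toℕ-fromℕ<; toℕ-injective; ¬∀⟶∃¬)
open import Data.List using (List; []; _∷_; length)
open import Data.List.Membership.Propositional using () renaming (_∈_ to _∈ˡ_)
open import Data.List.Relation.Unary.All as All using (_∷_)
open import Data.List.Relation.Unary.AllPairs using (_∷_)
open import Data.List.Relation.Unary.Any using (here; there)
open import Data.Nat using (ℕ; suc; _+_; _∸_; _≤_; z≤n; s≤s; NonZero)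
open import Data.Nat.DivMod using (_%_; _mod_; %-distribˡ-+; [m+n]%n≡m%n; m<n⇒m%n≡m; m%n<n)
open import Data.Nat.Properties using (+-assoc; +-comm; m+[n∸m]≡n)
open import Data.Product using (∃; ∃-syntax; _,_; proj₁; proj₂)
open import Data.Sum using (_⊎_; inj₁; inj₂; map; swap)
open import Data.Vec using (Vec; lookup)
open import Data.Vec.Properties using (≡-dec; tabulate∘lookup; tabulate-cong)
open import Function using (_∘_)
open import Function.Definitions using (Injective)
open import Level using (0ℓ)
open import Relation.Binary.Construct.Closure.ReflexiveTransitive using (ε; _◅_)
open import Relation.Binary.Definitions using (tri<; tri≈; tri>)
open import Relation.Binary.PropositionalEquality
  using (_≡_; _≢_; _≗_; refl; sym; trans; cong; module ≡-Reasoning)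
open import Relation.Nullary using (¬_; yes; no; contradiction)
open import Relation.Unary using (Pred; _∈_; _⊆_; _∪_)

-- Adding `K ∸ toℕ k`, an inverse of `k` modulo `K`, to both sides recovers the residues of `i` and
-- `j`, which are below `K` and so equal their residues.
%-cancelʳ-+ : ∀ {K} .{{_ : NonZero K}} (i j k : Fin K) →
  (toℕ i + toℕ k) % K ≡ (toℕ j + toℕ k) % K → i ≡ j
%-cancelʳ-+ {K} i j k eq = toℕ-injective (begin
  toℕ i                                             ≡⟨ shift i ⟩
  ((toℕ i + toℕ k) % K + (K ∸ toℕ k) % K) % K       ≡⟨ cong (λ m → (m + (K ∸ toℕ k) % K) % K) eq ⟩
  ((toℕ j + toℕ k) % K + (K ∸ toℕ k) % K) % K       ≡⟨ shift j ⟨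
  toℕ j                                             ∎)
  where
  open ≡-Reasoning
  shift : ∀ l → toℕ l ≡ ((toℕ l + toℕ k) % K + (K ∸ toℕ k) % K) % K
  shift l = begin
    toℕ l                                           ≡⟨ m<n⇒m%n≡m (toℕ<n l) ⟨
    toℕ l % K                                       ≡⟨ [m+n]%n≡m%n (toℕ l) K ⟨
    (toℕ l + K) % K                                 ≡⟨ cong (λ m → (toℕ l + m) % K) (m+[n∸m]≡n (toℕ≤n k)) ⟨
    (toℕ l + (toℕ k + (K ∸ toℕ k))) % K             ≡⟨ cong (_% K) (+-assoc (toℕ l) (toℕ k) _) ⟨
    (toℕ l + toℕ k + (K ∸ toℕ k)) % K               ≡⟨ %-distribˡ-+ (toℕ l + toℕ k) (K ∸ toℕ k) K ⟩
    ((toℕ l + toℕ k) % K + (K ∸ toℕ k) % K) % K     ∎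

+mod-cancelʳ : ∀ {K} (i j k : Fin K) → i +mod k ≡ j +mod k → i ≡ j
-- `i : Fin K` rules out `K = 0`; the pattern `suc _` supplies the `NonZero` instance.
+mod-cancelʳ {K@(suc _)} i j k eq = %-cancelʳ-+ i j k (begin
  (toℕ i + toℕ k) % K   ≡⟨ toℕ-fromℕ< (m%n<n (toℕ i + toℕ k) K) ⟨
  toℕ (i +mod k)        ≡⟨ cong toℕ eq ⟩
  toℕ (j +mod k)        ≡⟨ toℕ-fromℕ< (m%n<n (toℕ j + toℕ k) K) ⟩
  (toℕ j + toℕ k) % K   ∎)
  where open ≡-Reasoning

+mod-comm : ∀ {K} (i j : Fin K) → i +mod j ≡ j +mod i
+mod-comm {K@(suc _)} i j = cong (_mod K) (+-comm (toℕ i) (toℕ j))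

+mod-cancelˡ : ∀ {K} (k i j : Fin K) → k +mod i ≡ k +mod j → i ≡ j
+mod-cancelˡ k i j eq =
  +mod-cancelʳ i j k (trans (+mod-comm i k) (trans eq (+mod-comm k j)))

lookup-injective : ∀ {A : Set} {n} {xs ys : Vec A n} → lookup xs ≗ lookup ys → xs ≡ ys
lookup-injective {xs = xs} {ys} eq =
  trans (sym (tabulate∘lookup xs)) (trans (tabulate-cong eq) (tabulate∘lookup ys))

-- Equality in `Fin K` is decidable, so a finite search over the coordinates yields the witness
-- constructively.
≢⇒lookup≢ : ∀ {n K} {xs ys : Vec (Fin K) n} → xs ≢ ys → ∃[ r ] lookup xs r ≢ lookup ys r
≢⇒lookup≢ {n} {xs = xs} {ys} xs≢ys =
  ¬∀⟶∃¬ n _ (λ r → lookup xs r ≟ lookup ys r) (xs≢ys ∘ lookup-injective)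

module _ {E : Set} {R K : ℕ} (π : E → Vec (Fin K) R) where

  pair-label : ∀ {e r k} → pair r k ∈ starLabelling π e → k ≡ lookup (π e) r
  pair-label (inj₁ (_ , refl))         = refl
  pair-label (inj₂ (_ , _ , _ , ()))

  triple-label : ∀ {e r s k} .{r<s : r Fin.< s} → triple r s r<s k ∈ starLabelling π e →
    k ≡ lookup (π e) r +mod lookup (π e) s
  triple-label (inj₁ (_ , ()))
  triple-label (inj₂ (_ , _ , _ , refl)) = refl

  pair-covered : ∀ {f a b} → starLabelling π f ⊆ starLabelling π a ∪ starLabelling π b →
    ∀ r → lookup (π f) r ≡ lookup (π a) r ⊎ lookup (π f) r ≡ lookup (π b) r
  pair-covered f⊆ab r = map pair-label pair-label (f⊆ab (inj₁ (r , refl)))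

  triple-covered : ∀ {f a b} → starLabelling π f ⊆ starLabelling π a ∪ starLabelling π b →
    ∀ {r s} → r Fin.< s →
    lookup (π f) r +mod lookup (π f) s ≡ lookup (π a) r +mod lookup (π a) s ⊎
    lookup (π f) r +mod lookup (π f) s ≡ lookup (π b) r +mod lookup (π b) s
  triple-covered f⊆ab r<s = map triple-label triple-label (f⊆ab (inj₂ (_ , _ , r<s , refl)))

  mixed-triple-uncovered : ∀ {f a b} → starLabelling π f ⊆ starLabelling π a ∪ starLabelling π b →
    ∀ {r s} → r Fin.< s →
    lookup (π f) r ≢ lookup (π a) r → lookup (π f) s ≢ lookup (π b) s → ⊥
  mixed-triple-uncovered {f} {a} {b} f⊆ab {r} {s} r<s fr≢ar fs≢bs
    with pair-covered f⊆ab r | pair-covered f⊆ab s | triple-covered f⊆ab r<s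
  ... | inj₁ fr≡ar | _          | _       = fr≢ar fr≡ar
  ... | inj₂ _     | inj₂ fs≡bs | _       = fs≢bs fs≡bs
  -- `f` and `a` agree at `s`: cancelling that summand makes them agree at `r` too. The next case is
  -- the mirror image, with `b` and the summand at `r`.
  ... | inj₂ _     | inj₁ fs≡as | inj₁ eq =
    fr≢ar (+mod-cancelʳ _ _ (lookup (π f) s)
      (trans eq (cong (lookup (π a) r +mod_) (sym fs≡as))))
  ... | inj₂ fr≡br | inj₁ _     | inj₂ eq =
    fs≢bs (+mod-cancelˡ (lookup (π f) r) _ _
      (trans eq (cong (_+mod lookup (π b) s) (sym fr≡br))))

  -- Nothing requires `a ≢ b`, so this also serves for a single edge.
  covered-by-two : Injective _≡_ _≡_ π → ∀ {f a b} →
    starLabelling π f ⊆ starLabelling π a ∪ starLabelling π b → f ≡ a ⊎ f ≡ b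
  covered-by-two π-inj {f} {a} {b} f⊆ab
    with ≡-dec _≟_ (π f) (π a) | ≡-dec _≟_ (π f) (π b)
  ... | yes πf≡πa | _         = inj₁ (π-inj πf≡πa)
  ... | no _      | yes πf≡πb = inj₂ (π-inj πf≡πb)
  ... | no πf≢πa  | no πf≢πb
    with ≢⇒lookup≢ πf≢πa | ≢⇒lookup≢ πf≢πb
  ...   | r , fr≢ar | s , fs≢bs with <-cmp r s
  ...     | tri< r<s _ _ = contradiction fs≢bs (mixed-triple-uncovered f⊆ab r<s fr≢ar)
  -- Exchanging `a` and `b` puts the smaller coordinate first.
  ...     | tri> _ _ s<r = contradiction fr≢ar (mixed-triple-uncovered (swap ∘ f⊆ab) s<r fs≢bs)
  -- Here `f` differs from both edges at the same coordinate, so its pair there is already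
  -- uncovered.
  ...     | tri≈ _ refl _ with pair-covered f⊆ab r
  ...       | inj₁ fr≡ar = contradiction fr≡ar fr≢ar
  ...       | inj₂ fr≡br = contradiction fr≡br fs≢bs

  covered-by-at-most-two : 1 ≤ R → Injective _≡_ _≡_ π → ∀ {f} (es : List E) → length es ≤ 2 →
    starLabelling π f ⊆ labelOfSet (starLabelling π) (_∈ˡ es) → f ∈ˡ es
  -- `1 ≤ R` provides the coordinate `zero`, so the label of `f` is nonempty and cannot lie in the
  -- empty union.
  covered-by-at-most-two (s≤s _) _ [] _ f⊆es with f⊆es (inj₁ (zero , refl))
  ... | _ , () , _
  covered-by-at-most-two _ π-inj (a ∷ []) _ f⊆es
    -- The second edge is taken to be `a` again.
    with covered-by-two π-inj (λ x∈f → inj₁ (split (f⊆es x∈f)))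
    where
    split : labelOfSet (starLabelling π) (_∈ˡ a ∷ []) ⊆ starLabelling π a
    split (_ , here refl , x∈a) = x∈a
  ... | inj₁ f≡a = here f≡a
  ... | inj₂ f≡a = here f≡a
  covered-by-at-most-two _ π-inj (a ∷ b ∷ []) _ f⊆es
    with covered-by-two π-inj (split ∘ f⊆es)
    where
    split : labelOfSet (starLabelling π) (_∈ˡ a ∷ b ∷ []) ⊆ starLabelling π a ∪ starLabelling π b
    split (_ , here refl         , x∈a) = inj₁ x∈a
    split (_ , there (here refl) , x∈b) = inj₂ x∈b
  ... | inj₁ f≡a = here f≡a
  ... | inj₂ f≡b = there (here f≡b)
  covered-by-at-most-two _ _ (_ ∷ _ ∷ _ ∷ _) (s≤s (s≤s ()))

module _ {G : Graph} where
  open Graph G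

  source∈vertices : ∀ {u v} (p : Walk G u v) → u ∈ˡ vertices G p
  source∈vertices ε       = here refl
  source∈vertices (_ ◅ _) = here refl

  module _ {n : ℕ} (star : IsStarGraph G n) where
    open IsStarGraph star

    -- By `allEdges`, `e` also joins the centre to a leaf; the four cases compare the two
    -- orientations of each reading of `ends e`.
    centre-is-end : ∀ {e u v} → Joins e u v → u ≡ centre ⊎ v ≡ centre
    centre-is-end {e} euv with allEdges e
    centre-is-end (inj₁ p) | _ , inj₁ q = inj₁ (cong proj₁ (trans (sym p) q))
    centre-is-end (inj₁ p) | _ , inj₂ q = inj₂ (cong proj₂ (trans (sym p) q))
    centre-is-end (inj₂ p) | _ , inj₁ q = inj₂ (cong proj₁ (trans (sym p) q))
    centre-is-end (inj₂ p) | _ , inj₂ q = inj₁ (cong proj₂ (trans (sym p) q))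

    -- The first and third edges of a path have no common vertex, yet in a star both contain the
    -- centre.
    path-length≤2 : ∀ {u v} (p : Walk G u v) → IsPath G p → length (edges G p) ≤ 2
    path-length≤2 ε               _ = z≤n
    path-length≤2 (_ ◅ ε)         _ = s≤s z≤n
    path-length≤2 (_ ◅ _ ◅ ε)     _ = s≤s (s≤s z≤n)
    path-length≤2 ((_ , uv) ◅ _ ◅ (_ , wx) ◅ p) ((_ ∷ u≢w ∷ u≢p) ∷ (v≢w ∷ v≢p) ∷ _)
      with centre-is-end uv | centre-is-end wx
    ... | inj₁ refl | inj₁ refl = contradiction refl u≢w
    -- The far end of the third edge is the source of the remaining walk `p`, hence one of the
    -- vertices that `u` avoids.
    ... | inj₁ refl | inj₂ refl = contradiction refl (All.lookup u≢p (source∈vertices p))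
    ... | inj₂ refl | inj₁ refl = contradiction refl v≢w
    ... | inj₂ refl | inj₂ refl = contradiction refl (All.lookup v≢p (source∈vertices p))

proposition2 : (G : Graph) (n : ℕ) → 1 ≤ n → IsStarGraph G n →
    (R : ℕ) → 1 ≤ R → (K : ℕ) → IsCeilRoot R n K →
    (π : Graph.E G → Vec (Fin K) R) → Injective _≡_ _≡_ π →
    (S : Pred (Graph.E G) 0ℓ) → IsShortestPathEdgeSet G S →
    ¬ ∃ (FalsePositive (starLabelling π) S)
proposition2 G n _ star R 1≤R K _ π π-inj S
  (_ , _ , p , (isPath , _) , S⊆p , p⊆S) (f , f∉S , f⊆S) =
  f∉S (p⊆S (covered-by-at-most-two π 1≤R π-inj (edges G p) (path-length≤2 star p isPath)
    λ x∈f → let e , e∈S , x∈e = f⊆S x∈f in e , S⊆p e∈S , x∈e))
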